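{- Let $\kappa$ be an infinite cardinal and $\mathtt{PROP}$ a set of propositional variables with $|\mathtt{PROP}|\geq\kappa^+$. Let $H$ be a Hilbert-style formal system for $L_{\kappa^+\omega}^{\rightarrow}$ which is sound with respect to some $V_{\mathbf S}$ (the class of models corresponding to some system $\mathbf S$ of relevant logic between $\mathbf B$ and $\mathbf{RM}$). Then $H$ is not strongly complete with respect to $V_{\mathbf S}$.
   Context: Language. Given a set $\mathtt{PROP}$ of propositional variables and an infinite cardinal $\mu$, the formulas of $L_{\mu\omega}^{\rightarrow}$ are generated by $\phi ::= p \mid \bot \mid {\sim}\phi \mid \bigwedge_{i\in I}\phi_i \mid \bigvee_{i\in I}\phi_i \mid \phi\rightarrow\psi$, with $p\in\mathtt{PROP}$ and $|I|<\mu$. Models. A (Routley–Meyer) model is $M=\langle W,R,*,T,V\rangle$ with $W$ a non-empty set, $T\in W$, $*:W\to W$ (written $w\mapsto w^*$), $R\subseteq W^3$, and $V:\mathtt{PROP}\to\wp(W)$. Satisfaction: $M,w\Vdash\bot$ never; $M,w\Vdash p$ iff $w\in V(p)$; $M,w\Vdash{\sim}\phi$ iff $M,w^*\nVdash\phi$; $M,w\Vdash\bigwedge_{i\in I}\phi_i$ iff $M,w\Vdash\phi_i$ for every $i\in I$; $M,w\Vdash\bigvee_{i\in I}\phi_i$ iff $M,w\Vdash\phi_i$ for some $i\in I$; $M,w\Vdash\phi\rightarrow\psi$ iff for all $a,b$ with $Rwab$, if $M,a\Vdash\phi$ then $M,b\Vdash\psi$. A $\mathbf B$-model is a model such that for all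 $x,y,z,v\in W$: $RTxx$; $RTxv$ and $Rvyz$ imply $Rxyz$; $x=x^{**}$; $RTxy$ implies $RTy^*x^*$; and $x\in V(p)$ and $RTxy$ imply $y\in V(p)$ for all $p \in \mathtt{PROP}$. An $\mathbf R$-model is a $\mathbf B$-model such that for all $x,y,z,v$: $Rzxy$ implies $Rzy^*x^*$; if there is $u$ with $Rxyu$ and $Ruzv$, then there is $u$ with $Rxuv$ and $Ryzu$; $Rxxx$; $Rxyz$ implies $Ryxz$. An $\mathbf{RM}$-model is an $\mathbf R$-model such that for all $x,y,z$: $Rxyz$ implies $RTxz$ or $RTyz$. $V_{\mathbf B}$ and $V_{\mathbf{RM}}$ denote the classes of $\mathbf B$-models and $\mathbf{RM}$-models. For a system $\mathbf S$ between $\mathbf B$ and $\mathbf{RM}$, $V_{\mathbf S}$ is the class of all $\mathbf B$-models satisfying certain further first-order conditions on $R,*,T$ (depending on $\mathbf S$), with $V_{\mathbf{RM}}\subseteq V_{\mathbf S}\subseteq V_{\mathbf B}$. Semantic consequence. A set of formulas $\Gamma$ semantically implies $\phi$ over $V_{\mathbf S}$ if for every $M\in V_{\mathbf S}$ with $M,T\Vdash\gamma$ for all $\gamma\in\Gamma$, also $M,T\Vdash\phi$. Formal systems. A Hilbert-style formal system $H$ for $L_{\mu\omega}^{\rightarrow}$ consists of a set of formulas of $L_{\mu\omega}^{\rightarrow}$ (axioms) and a collection of rules of inference each with fewer than $\mu$ premises. $\Gamma\vdash_H\phi$ means that there is a (possibly transfinite) sequence of formulas of length less than $\mu$, ending with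 $\phi$, each of whose members is an axiom, a member of $\Gamma$, or follows from previous members by one of the rules. $H$ is sound with respect to $V_{\mathbf S}$ if $\Gamma\vdash_H\phi$ implies that $\Gamma$ semantically implies $\phi$ over $V_{\mathbf S}$, for every set of formulas $\Gamma$ and formula $\phi$; $H$ is strongly complete if the converse implication holds for every set of formulas $\Gamma$ and formula $\phi$. -}

module Defs where

open import Level using (Level; suc)
open import Data.Empty.Polymorphic using (⊥)
open import Data.Fin.Base using (Fin)
open import Data.Nat.Base as ℕ using (ℕ)
open import Data.Product.Base using (∃-syntax; Σ-syntax; _×_)
open import Data.Refinement.Base using (Refinement; value)
open import Data.Sum.Base using (_⊎_)
open import Data.Vec.Base using (Vec; []; _∷_; lookup)
open import Function.Bundles using (_↔_; _↣_)
open import Induction.WellFounded using (WellFounded)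
open import Relation.Binary.Core using (Rel)
open import Relation.Binary.PropositionalEquality.Core using (_≡_)
open import Relation.Binary.Structures using (IsStrictTotalOrder)
open import Relation.Nullary.Negation.Core using (¬_)
open import Relation.Unary using (Pred)

------------------------------------------------------------------------
-- Cardinals

-- A cardinal is an initial ordinal: a well-order that is not equinumerous
-- with any of its proper initial segments. The refinement type makes the
-- proof of x < a irrelevant, so an initial segment is a genuine subset.

record Cardinal (ℓ : Level) : Set (suc ℓ) where
  infix 4 _<_
  field
    Carrier            : Set ℓ
    _<_                : Rel Carrier ℓ
    isStrictTotalOrder : IsStrictTotalOrder _≡_ _<_
    wellFounded        : WellFounded _<_

  Seg : Carrier → Set ℓ
  Seg a = Refinement Carrier (_< a)

  field
    initial : ∀ a → ¬ (Carrier ↔ Seg a)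

open Cardinal using (Carrier; Seg)

-- The ordinals smaller than μ are the elements of μ, and the ordinal a is
-- the set Seg μ a. So the cardinality of I is smaller than μ when I is
-- equinumerous with some Seg μ a.

∣_∣<_ : ∀ {ℓ} → Set ℓ → Cardinal ℓ → Set ℓ
∣ I ∣< μ = ∃[ a ] (I ↔ Seg μ a)

∣_∣≥_ : ∀ {ℓ} → Set ℓ → Cardinal ℓ → Set ℓ
∣ X ∣≥ μ = Carrier μ ↣ X

Infinite : ∀ {ℓ} → Cardinal ℓ → Set ℓ
Infinite μ = ℕ ↣ Carrier μ

-- μ is the least cardinal greater than κ.

IsSuccessorOf : ∀ {ℓ} → Cardinal ℓ → Cardinal ℓ → Set (suc ℓ)
IsSuccessorOf μ κ =
  (∣ Carrier κ ∣< μ) × (∀ ν → ∣ Carrier κ ∣< ν → ∣ Carrier ν ∣≥ μ)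

------------------------------------------------------------------------
-- Routley–Meyer models

record Model {ℓ} (PROP : Set ℓ) : Set (suc ℓ) where
  field
    W  : Set ℓ
    R  : W → W → W → Set ℓ
    _* : W → W
    T  : W
    V  : PROP → Pred W ℓ

  infix 20 _*

module _ {ℓ} {PROP : Set ℓ} where

  record IsB (M : Model PROP) : Set ℓ where
    open Model M
    field
      T-refl   : ∀ x → R T x x
      T-trans  : ∀ x y z v → R T x v → R v y z → R x y z
      *-invol  : ∀ x → x ≡ (x *) *
      *-anti   : ∀ x y → R T x y → R T (y *) (x *)
      heredity : ∀ p x y → V p x → R T x y → V p y

  record IsR (M : Model PROP) : Set ℓ where
    open Model M
    field
      isB      : IsB M
      contra   : ∀ x y z → R z x y → R z (y *) (x *)
      assoc    : ∀ x y z v → ∃[ u ] (R x y u × R u z v) →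
                 ∃[ u ] (R x u v × R y z u)
      diag     : ∀ x → R x x x
      exchange : ∀ x y z → R x y z → R y x z

  record IsRM (M : Model PROP) : Set ℓ where
    open Model M
    field
      isR    : IsR M
      mingle : ∀ x y z → R x y z → R T x z ⊎ R T y z

------------------------------------------------------------------------
-- First-order conditions on R, * and T

data Term (n : ℕ) : Set where
  var : Fin n → Term n
  T   : Term n
  _*  : Term n → Term n

-- A quantifier binds the variable Fin.zero of its body.

infix  6 _≐_
infixr 5 _∧_
infixr 4 _∨_
infixr 3 _⇒_

data FO (n : ℕ) : Set where
  R       : Term n → Term n → Term n → FO n
  _≐_     : Term n → Term n → FO n
  ⊥′      : FO n
  _∧_ _∨_ : FO n → FO n → FO n
  _⇒_     : FO n → FO n → FO n
  ∀′ ∃′   : FO (ℕ.suc n) → FO n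

Sentence : Set
Sentence = FO 0

module _ {ℓ} {PROP : Set ℓ} (M : Model PROP) where
  private module M = Model M

  ⟦_⟧ : ∀ {n} → Term n → Vec M.W n → M.W
  ⟦ var i ⟧ ρ = lookup ρ i
  ⟦ T     ⟧ ρ = M.T
  ⟦ t *   ⟧ ρ = ⟦ t ⟧ ρ M.*

  Holds : ∀ {n} → FO n → Vec M.W n → Set ℓ
  Holds (R s t u) ρ = M.R (⟦ s ⟧ ρ) (⟦ t ⟧ ρ) (⟦ u ⟧ ρ)
  Holds (s ≐ t)   ρ = ⟦ s ⟧ ρ ≡ ⟦ t ⟧ ρ
  Holds ⊥′        ρ = ⊥
  Holds (α ∧ β)   ρ = Holds α ρ × Holds β ρ
  Holds (α ∨ β)   ρ = Holds α ρ ⊎ Holds β ρ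
  Holds (α ⇒ β)   ρ = Holds α ρ → Holds β ρ
  Holds (∀′ α)    ρ = ∀ w → Holds α (w ∷ ρ)
  Holds (∃′ α)    ρ = ∃[ w ] Holds α (w ∷ ρ)

-- The class of B-models satisfying the conditions Θ.

record 𝕍 {ℓ} {PROP : Set ℓ} (Θ : Pred Sentence ℓ) (M : Model PROP) : Set ℓ where
  field
    isB   : IsB M
    holds : ∀ θ → Θ θ → Holds M θ []

------------------------------------------------------------------------
-- The language with conjunctions and disjunctions of size < μ

-- Which bijection witnesses ∣ I ∣< μ is not part of the formula; hence the
-- irrelevant arguments.

infix  8 ∼_
infixr 5 _⟶_

data Formula {ℓ} (PROP : Set ℓ) (μ : Cardinal ℓ) : Set (suc ℓ) where
  atom : PROP → Formula PROP μ
  ⊥′   : Formula PROP μ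
  ∼_   : Formula PROP μ → Formula PROP μ
  ⋀ ⋁  : (I : Set ℓ) → .(∣ I ∣< μ) → (I → Formula PROP μ) → Formula PROP μ
  _⟶_  : Formula PROP μ → Formula PROP μ → Formula PROP μ

module _ {ℓ} {PROP : Set ℓ} {μ : Cardinal ℓ} where

  infix 4 _,_⊩_

  _,_⊩_ : (M : Model PROP) → Model.W M → Formula PROP μ → Set ℓ
  M , w ⊩ atom p  = Model.V M p w
  M , w ⊩ ⊥′      = ⊥
  M , w ⊩ ∼ φ     = ¬ (M , Model._* M w ⊩ φ)
  M , w ⊩ ⋀ I _ φ = ∀ i → M , w ⊩ φ i
  M , w ⊩ ⋁ I _ φ = ∃[ i ] (M , w ⊩ φ i)
  M , w ⊩ φ ⟶ ψ   = ∀ a b → Model.R M w a b → M , a ⊩ φ → M , b ⊩ ψ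

-- Index sets range over all of Set ℓ, so Formula is a proper class relative
-- to Set ℓ and a predicate on it need not be a set. A set of formulas is
-- the range of a family indexed by a type in Set ℓ.

record FormulaSet {ℓ} (PROP : Set ℓ) (μ : Cardinal ℓ) : Set (suc ℓ) where
  field
    Index  : Set ℓ
    member : Index → Formula PROP μ

module _ {ℓ} {PROP : Set ℓ} {μ : Cardinal ℓ} where

  infix 4 _∈_

  _∈_ : Formula PROP μ → FormulaSet PROP μ → Set (suc ℓ)
  φ ∈ Γ = ∃[ j ] (FormulaSet.member Γ j ≡ φ)

  Implies : Pred Sentence ℓ → FormulaSet PROP μ → Formula PROP μ → Set (suc ℓ)
  Implies Θ Γ φ = ∀ M → 𝕍 Θ M →
    (∀ γ → γ ∈ Γ → M , Model.T M ⊩ γ) → M , Model.T M ⊩ φ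

------------------------------------------------------------------------
-- Hilbert-style systems

-- A rule is a relation between families of premises, indexed by a type of
-- cardinality < μ, and conclusions. Axioms and rules are not required to be
-- small, so that they may be schematic in formulas.

record HilbertSystem {ℓ} (PROP : Set ℓ) (μ : Cardinal ℓ) : Set (suc (suc ℓ)) where
  field
    Axiom    : Pred (Formula PROP μ) (suc ℓ)
    Rule     : Set (suc ℓ)
    Premise  : Rule → Set ℓ
    few      : ∀ r → ∣ Premise r ∣< μ
    Instance : ∀ r → (Premise r → Formula PROP μ) → Formula PROP μ → Set (suc ℓ)

module _ {ℓ} {PROP : Set ℓ} {μ : Cardinal ℓ} (H : HilbertSystem PROP μ) where
  open HilbertSystem H
  open Cardinal μ using (_<_)

  -- A sequence of length a is a family indexed by the ordinals below a.

  record Derivation (Γ : FormulaSet PROP μ) (φ : Formula PROP μ) : Set (suc ℓ) where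
    field
      length : Carrier μ
      seq    : Seg μ length → Formula PROP μ
      end    : Seg μ length
      isLast : ∀ (i : Seg μ length) → ¬ (value end < value i)
      ends   : seq end ≡ φ
      step   : ∀ i →
        Axiom (seq i) ⊎
        seq i ∈ Γ ⊎
        ∃[ r ] ∃[ ψ ] (Instance r ψ (seq i) ×
          (∀ k → Σ[ j ∈ Seg μ length ] (value j < value i × seq j ≡ ψ k)))

  Sound : Pred Sentence ℓ → Set (suc ℓ)
  Sound Θ = ∀ Γ φ → Derivation Γ φ → Implies Θ Γ φ

  StronglyComplete : Pred Sentence ℓ → Set (suc ℓ)
  StronglyComplete Θ = ∀ Γ φ → Implies Θ Γ φ → Derivation Γ φ

{-# OPTIONS --safe #-}

-- The theory Γ of an injection from κ⁺ into κ, with atoms p α i for α < κ⁺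
-- and i < κ, says that each α has some value i and that no value is shared.
-- It has no model, so it implies ⊥. A derivation of ⊥ has length < κ⁺, so it
-- uses at most κ of the disjunctions in Γ; their indices can be sent
-- injectively into κ, and so the used part of Γ holds in a one-point
-- RM-model, against soundness.
--
-- Choosing the atoms requires κ⁺ × κ ↣ κ⁺. The cardinal arithmetic is done
-- without choice: Cantor–Bernstein, comparability of well-orders, and
-- Hessenberg's theorem via Gödel's well-order on pairs.

module Submission where

open import Level using (Level; suc; _⊔_; 0ℓ; lift; lower)
open import Axiom.ExcludedMiddle using (ExcludedMiddle)
open import Data.Fin.Base using (Fin; fromℕ<; combine)
open import Data.Fin.Properties
  using (fromℕ<-injective; combine-injective; ℕ→Fin-notInjective)
import Data.Irrelevant as Irrelevant
open import Data.Maybe.Base as Maybe using (Maybe; just; nothing; maybe′)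
open import Data.Maybe.Properties using (just-injective)
open import Data.Nat.Base as ℕ using (ℕ; zero)
open import Data.Nat.Induction using (<-wellFounded)
import Data.Nat.Properties as ℕ
open import Data.Product.Base using (∃; ∃-syntax; Σ-syntax; _×_; _,_; proj₁; proj₂)
open import Data.Product.Function.NonDependent.Propositional using (_×-↣_)
open import Data.Product.Properties using (,-injectiveˡ; ,-injectiveʳ)
open import Data.Product.Relation.Binary.Lex.Strict
  using (×-isStrictTotalOrder; ×-wellFounded)
open import Data.Refinement.Base using (Refinement; value; _,_)
open import Data.Refinement.Properties using (value-injective)
open import Data.Sum.Base as Sum using (_⊎_; inj₁; inj₂)
open import Data.Sum.Properties using (inj₁-injective)
open import Data.Unit.Polymorphic.Base using (⊤; tt)
open import Function.Base using (_∘_; _on_; id)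
open import Function.Bundles using (_↣_; _↔_; mk↣; mk⤖; Injection; mk↔ₛ′)
open import Function.Consequences.Propositional using (strictlySurjective⇒surjective)
open import Function.Definitions using (Injective; StrictlySurjective)
open import Function.Properties.Bijection using (⤖⇒↔)
open import Function.Properties.Injection using (↣-trans)
open import Function.Properties.Inverse using (↔⇒↣; ↔-sym)
open import Induction.WellFounded using (WellFounded; Acc; acc)
import Relation.Binary.Construct.On as On
open import Relation.Binary.Core using (Rel)
open import Relation.Binary.Definitions using (Tri; tri<; tri≈; tri>)
open import Relation.Binary.PropositionalEquality
  using (_≡_; _≢_; refl; sym; trans; cong; cong₂; subst; isEquivalence)
open import Relation.Binary.Structures using (IsStrictTotalOrder)
open import Relation.Binary.Structures.Biased using (isStrictTotalOrderᶜ)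
open import Relation.Nullary.Decidable
  using (Dec; yes; no; map′; recompute; decidable-stable)
open import Relation.Nullary.Negation.Core using (¬_; contradiction)
open import Relation.Unary using (Pred; _⊆_)
open import Defs

private variable
  a b r ℓ : Level

-- Classical preliminaries.

lower-em : ExcludedMiddle (suc ℓ) → ExcludedMiddle ℓ
lower-em em = map′ lower lift em

↔-from-bijective : ∀ {A : Set a} {B : Set b} (f : A → B) →
  Injective _≡_ _≡_ f → StrictlySurjective _≡_ f → A ↔ B
↔-from-bijective f inj surj =
  ⤖⇒↔ (mk⤖ {to = f} (inj , strictlySurjective⇒surjective surj))

-- The Cantor-Bernstein theorem.

module CantorBernstein (em : ExcludedMiddle (a ⊔ b))
  {A : Set a} {B : Set b} (A↣B : A ↣ B) (B↣A : B ↣ A) where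

  private
    module F = Injection A↣B
    module G = Injection B↣A

  -- The elements whose backward orbit under A↣B and B↣A stops in A.
  data FromA : A → Set (a ⊔ b) where
    base : ∀ {x} → (∀ y → G.to y ≢ x) → FromA x
    step : ∀ {x} → FromA x → FromA (G.to (F.to x))

  private
    -- Matching on `FromA (G.to y)` directly would have to unify `G.to y` with `G.to (F.to x)`; here
    -- the index is a variable and the equation is returned.
    FromA⁻¹ : ∀ {x} → FromA x → (∀ y → G.to y ≢ x) ⊎ ∃[ w ] (FromA w × G.to (F.to w) ≡ x)
    FromA⁻¹ (base ∉G) = inj₁ ∉G
    FromA⁻¹ (step p)  = inj₂ (_ , p , refl)

    preimage : ∀ {x} → ¬ FromA x → ∃[ y ] G.to y ≡ x
    preimage ¬p = decidable-stable em λ ∉G → ¬p (base λ y eq → ∉G (y , eq))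

    -- The decision is an argument, so that the lemmas can split on it and not on `em`.
    h? : ∀ {x} → Dec (FromA x) → B
    h? {x} (yes _) = F.to x
    h? (no ¬p)     = proj₁ (preimage ¬p)

    h?-injective : ∀ {x y} (p? : Dec (FromA x)) (q? : Dec (FromA y)) →
      h? p? ≡ h? q? → x ≡ y
    h?-injective (yes p) (yes q) eq = F.injective eq
    -- A collision would make `y` equal to `G.to (F.to x)`, which `step` puts in `FromA`.
    h?-injective (yes p) (no ¬q) eq =
      contradiction (subst FromA (trans (cong G.to eq) (proj₂ (preimage ¬q))) (step p)) ¬q
    h?-injective (no ¬p) (yes q) eq =
      contradiction (subst FromA (trans (cong G.to (sym eq)) (proj₂ (preimage ¬p))) (step q)) ¬p
    h?-injective (no ¬p) (no ¬q) eq =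
      trans (sym (proj₂ (preimage ¬p))) (trans (cong G.to eq) (proj₂ (preimage ¬q)))

    h?-yes : ∀ {x} → FromA x → (p? : Dec (FromA x)) → h? p? ≡ F.to x
    h?-yes p (yes _) = refl
    h?-yes p (no ¬p) = contradiction p ¬p

    -- Outside `FromA`, `G.to y` is sent back to `y`. Inside, being in the range of `G.to`, it
    -- arises by `step` from some `x`, and then `F.to x` is `y`.
    h?-surjective : ∀ y → Dec (FromA (G.to y)) → ∃[ x ] h? {x} em ≡ y
    h?-surjective y (no ¬p) = G.to y , lemma em
      where
      lemma : (p? : Dec (FromA (G.to y))) → h? p? ≡ y
      lemma (yes p) = contradiction p ¬p
      lemma (no ¬p) = G.injective (proj₂ (preimage ¬p))
    h?-surjective y (yes p) with FromA⁻¹ p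
    ... | inj₁ ∉G          = contradiction refl (∉G y)
    ... | inj₂ (x , q , eq) = x , trans (h?-yes q em) (G.injective eq)

  cantor-bernstein : A ↔ B
  cantor-bernstein = ↔-from-bijective (λ x → h? {x} em)
    (h?-injective em em) (λ y → h?-surjective y em)

open CantorBernstein using (cantor-bernstein)

-- Least elements and least counterexamples.

module _ {a b} (em : ExcludedMiddle (a ⊔ b)) {A : Set a} {_<_ : Rel A a}
  (wf : WellFounded _<_) (P : Pred A (a ⊔ b)) where

  least : ∃ P → ∃[ m ] (P m × (∀ {y} → y < m → ¬ P y))
  least (x , px) = go (wf x) px
    where
    go : ∀ {x} → Acc _<_ x → P x → ∃[ m ] (P m × (∀ {y} → y < m → ¬ P y))
    go {x} (acc rs) px with em {∃[ y ] (y < x × P y)}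
    ... | yes (y , y<x , py) = go (rs y<x) py
    ... | no ∄y              = x , px , λ y<x py → ∄y (_ , y<x , py)

¬∀⟶least-failure : ∀ {a b} (em : ExcludedMiddle (a ⊔ b)) {A : Set a} {_<_ : Rel A a} →
  WellFounded _<_ → (P : Pred A (a ⊔ b)) → ¬ (∀ x → P x) →
  ∃[ m ] (¬ P m × (∀ {y} → y < m → P y))
¬∀⟶least-failure {a} {b} em wf P ¬∀
  with least {a} {b} em wf (λ x → ¬ P x)
         (decidable-stable em λ ∄ → ¬∀ λ x → decidable-stable em λ ¬p → ∄ (x , ¬p))
... | m , ¬p , below = m , ¬p , λ y<m → decidable-stable em (below y<m)

-- Well-orders and their initial segments.

record WellOrder a : Set (suc a) where
  infix 4 _<_
  field
    Carrier            : Set a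
    _<_                : Rel Carrier a
    isStrictTotalOrder : IsStrictTotalOrder _≡_ _<_
    wellFounded        : WellFounded _<_

  open IsStrictTotalOrder isStrictTotalOrder public
    using (compare; irrefl; asym; _<?_) renaming (trans to <-trans)

  Seg : Carrier → Set a
  Seg x = Refinement Carrier (_< x)

  -- Membership is stored irrelevantly; decidability of `_<_` recovers it.
  Seg< : ∀ {x} (y : Seg x) → value y < x
  Seg< {x} (y , Irrelevant.[ p ]) = recompute (y <? x) p

  value↣ : ∀ {x} → Seg x ↣ Carrier
  value↣ = mk↣ value-injective

  Seg-mono : ∀ {x y} → x < y → Seg x ↣ Seg y
  Seg-mono x<y = mk↣ {to = λ z → value z , Irrelevant.[ <-trans (Seg< z) x<y ]}
    (value-injective ∘ cong value)

fromCardinal : Cardinal a → WellOrder a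
fromCardinal μ = record { Cardinal μ }

-- `_≈_` is not fixed to be `_≡_`, because the lexicographic product used later is a strict total
-- order for pointwise equality.
pullback : ∀ {A : Set a} {B : Set b} {_≈_ : Rel B r} {_<_ : Rel B a} →
  IsStrictTotalOrder _≈_ _<_ → WellFounded _<_ →
  (f : A → B) → Injective _≡_ _≈_ f → WellOrder a
pullback {A = A} {_≈_ = _≈_} {_<_} sto wf f inj = record
  { Carrier            = A
  ; _<_                = _<_ on f
  ; isStrictTotalOrder = isStrictTotalOrderᶜ record
    { isEquivalence = isEquivalence
    ; trans         = O.trans
    ; compare       = λ x y → tri (O.compare (f x) (f y))
    }
  ; wellFounded        = On.wellFounded f wf
  }
  where
  module O = IsStrictTotalOrder sto
  tri : ∀ {x y} → Tri (f x < f y) (f x ≈ f y) (f y < f x) → Tri (f x < f y) (x ≡ y) (f y < f x)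
  tri (tri< p ¬q ¬r) = tri< p (λ { refl → ¬q O.Eq.refl }) ¬r
  tri (tri≈ ¬p q ¬r) = tri≈ ¬p (inj q) ¬r
  tri (tri> ¬p ¬q r) = tri> ¬p (λ { refl → ¬q O.Eq.refl }) r

ℕ-wellOrder : WellOrder 0ℓ
ℕ-wellOrder = record
  { Carrier            = ℕ
  ; _<_                = ℕ._<_
  ; isStrictTotalOrder = ℕ.<-isStrictTotalOrder
  ; wellFounded        = <-wellFounded
  }

segment : (A : WellOrder a) → WellOrder.Carrier A → WellOrder a
segment A x = pullback isStrictTotalOrder wellFounded (value {P = _< x}) value-injective
  where open WellOrder A

module _ (A : WellOrder a) {x : WellOrder.Carrier A} where
  open WellOrder A

  segment-Seg : (d : Seg x) → WellOrder.Seg (segment A x) d ↔ Seg (value d)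
  segment-Seg d = mk↔ₛ′
    (λ y → value (value y) , Irrelevant.[ WellOrder.Seg< (segment A x) {d} y ])
    (λ y → (value y , Irrelevant.[ <-trans (Seg< y) (Seg< d) ]) , Irrelevant.[ Seg< y ])
    (λ _ → refl) (λ _ → refl)

-- Comparability of well-orders.

module Comparability (em : ExcludedMiddle (a ⊔ b)) (A : WellOrder a) (B : WellOrder b) where
  private
    module A = WellOrder A
    module B = WellOrder B

  -- x ~ y says that the segments below x and y are order isomorphic.
  data _~_ (x : A.Carrier) (y : B.Carrier) : Set (a ⊔ b) where
    mk : (∀ x′ → x′ A.< x → ∃[ y′ ] (y′ B.< y × x′ ~ y′)) →
         (∀ y′ → y′ B.< y → ∃[ x′ ] (x′ A.< x × x′ ~ y′)) → x ~ y

  forth : ∀ {x y x′} → x ~ y → x′ A.< x → ∃[ y′ ] (y′ B.< y × x′ ~ y′)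
  forth (mk f _) = f _

  back : ∀ {x y y′} → x ~ y → y′ B.< y → ∃[ x′ ] (x′ A.< x × x′ ~ y′)
  back (mk _ g) = g _

  -- Induction on `x`: if `y < y′`, then `y` is matched with some `x′ < x`, which is also matched
  -- with some `y″ < y`; by induction `y″ ≡ y`, which is absurd.
  functional : ∀ {x y y′} → x ~ y → x ~ y′ → y ≡ y′
  functional = go (A.wellFounded _)
    where
    go : ∀ {x y y′} → Acc A._<_ x → x ~ y → x ~ y′ → y ≡ y′
    absurd : ∀ {x y y′} → Acc A._<_ x → x ~ y → x ~ y′ → ¬ (y B.< y′)
    go {y = y} {y′} ac p q with B.compare y y′
    ... | tri< y<y′ _ _ = contradiction y<y′ (absurd ac p q)
    ... | tri≈ _ eq _   = eq
    ... | tri> _ _ y′<y = contradiction y′<y (absurd ac q p)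
    absurd (acc rs) p q y<y′ with back q y<y′
    ... | x′ , x′<x , r with forth p x′<x
    ... | y″ , y″<y , s = B.irrefl (go (rs x′<x) s r) y″<y

  injective : ∀ {x x′ y} → x ~ y → x′ ~ y → x ≡ x′
  injective = go (B.wellFounded _)
    where
    go : ∀ {x x′ y} → Acc B._<_ y → x ~ y → x′ ~ y → x ≡ x′
    absurd : ∀ {x x′ y} → Acc B._<_ y → x ~ y → x′ ~ y → ¬ (x A.< x′)
    go {x} {x′} ac p q with A.compare x x′
    ... | tri< x<x′ _ _ = contradiction x<x′ (absurd ac p q)
    ... | tri≈ _ eq _   = eq
    ... | tri> _ _ x′<x = contradiction x′<x (absurd ac q p)
    absurd (acc rs) p q x<x′ with forth q x<x′
    ... | y′ , y′<y , r with back p y′<y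
    ... | x″ , x″<x , s = A.irrefl (go (rs y′<y) s r) x″<x

  private
    TotalA TotalB : Set (a ⊔ b)
    TotalA = ∀ x → ∃[ y ] x ~ y
    TotalB = ∀ y → ∃[ x ] x ~ y

    -- By `forth` the matched points are downward closed, so an unmatched point lies above all of
    -- them.
    boundA : ∀ {x} → ¬ (∃[ y ] x ~ y) → ∀ {x′ y′} → x′ ~ y′ → x′ A.< x
    boundA {x} ∄y {x′} p with A.compare x′ x
    ... | tri< x′<x _ _ = x′<x
    ... | tri≈ _ refl _ = contradiction (_ , p) ∄y
    ... | tri> _ _ x<x′ = let y , _ , q = forth p x<x′ in contradiction (y , q) ∄y

    boundB : ∀ {y} → ¬ (∃[ x ] x ~ y) → ∀ {x′ y′} → x′ ~ y′ → y′ B.< y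
    boundB {y} ∄x {y′ = y′} p with B.compare y′ y
    ... | tri< y′<y _ _ = y′<y
    ... | tri≈ _ refl _ = contradiction (_ , p) ∄x
    ... | tri> _ _ y<y′ = let x , _ , q = back p y<y′ in contradiction (x , q) ∄x

    totalB⇒B↣A : TotalB → B.Carrier ↣ A.Carrier
    totalB⇒B↣A f = mk↣ {to = λ y → proj₁ (f y)} λ {y} {y′} eq →
      functional (proj₂ (f y)) (subst (_~ y′) (sym eq) (proj₂ (f y′)))

    -- If both orders had unmatched points, everything below the least ones `x` and `y` would be
    -- matched, with partners below `y` and `x` by the bounds, so `x ~ y` after all.
    ¬totalA⇒totalB : ¬ TotalA → TotalB
    ¬totalA⇒totalB ¬f with ¬∀⟶least-failure {a} {b} em A.wellFounded _ ¬f
    ... | x , ∄y , f = decidable-stable em λ ¬g →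
      let y , ∄x , g = ¬∀⟶least-failure {b} {a} em B.wellFounded _ ¬g
          f′ : ∀ x′ → x′ A.< x → ∃[ y′ ] (y′ B.< y × x′ ~ y′)
          f′ x′ x′<x = let y′ , p = f x′<x in y′ , boundB ∄x p , p
          g′ : ∀ y′ → y′ B.< y → ∃[ x′ ] (x′ A.< x × x′ ~ y′)
          g′ y′ y′<y = let x′ , p = g y′<y in x′ , boundA ∄y p , p
      in ∄y (y , mk f′ g′)

    -- The matched part of `B` is exactly the segment below its least unmatched point.
    totalA⇒A↔Seg : TotalA → ¬ TotalB → ∃[ y ] (A.Carrier ↔ B.Seg y)
    totalA⇒A↔Seg f ¬g with ¬∀⟶least-failure {b} {a} em B.wellFounded _ ¬g
    ... | y , ∄x , g = y , ↔-from-bijective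
      (λ x → proj₁ (f x) , Irrelevant.[ boundB ∄x (proj₂ (f x)) ])
      (λ {x} {x′} eq → injective (proj₂ (f x))
        (subst (x′ ~_) (sym (cong value eq)) (proj₂ (f x′))))
      λ z → let x , p = g (B.Seg< z) in x , value-injective (functional (proj₂ (f x)) p)

  comparable : (B.Carrier ↣ A.Carrier) ⊎ ∃[ y ] (A.Carrier ↔ B.Seg y)
  comparable with em {TotalA} | em {TotalB}
  ... | _     | yes g = inj₁ (totalB⇒B↣A g)
  ... | no ¬f | no ¬g = contradiction (¬totalA⇒totalB ¬f) ¬g
  ... | yes f | no ¬g = inj₂ (totalA⇒A↔Seg f ¬g)

open Comparability using (comparable)

-- Finite and infinite sets.

Maybe-↣ : ∀ {A : Set a} {B : Set b} → A ↣ B → Maybe A ↣ Maybe B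
Maybe-↣ {A = A} {B} f = mk↣ {to = to} λ {x} {y} → inj x y
  where
  to : Maybe A → Maybe B
  to = Maybe.map (Injection.to f)
  inj : ∀ x y → to x ≡ to y → x ≡ y
  inj nothing  nothing  _  = refl
  inj (just _) (just _) eq = cong just (Injection.injective f (just-injective eq))

Maybe-Fin↣Fin : ∀ {n} → Maybe (Fin n) ↣ Fin (ℕ.suc n)
Maybe-Fin↣Fin = mk↣ {to = maybe′ Fin.suc Fin.zero} λ {x} {y} → inj x y
  where
  inj : ∀ {n} (x y : Maybe (Fin n)) →
    maybe′ Fin.suc Fin.zero x ≡ maybe′ Fin.suc Fin.zero y → x ≡ y
  inj nothing  nothing  _    = refl
  inj (just _) (just _) refl = refl

Fin-×↣ : ∀ {m n} → (Fin m × Fin n) ↣ Fin (m ℕ.* n)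
Fin-×↣ = mk↣ {to = λ (i , j) → combine i j} λ {(i , j)} {(k , l)} eq →
  let i≡k , j≡l = combine-injective i j k l eq in cong₂ _,_ i≡k j≡l

ℕ-not-↣Fin : ∀ {n} → ¬ (ℕ ↣ Fin n)
ℕ-not-↣Fin f = ℕ→Fin-notInjective (Injection.to f) (Injection.injective f)

-- Hilbert's hotel.
Maybe-↣-infinite : ExcludedMiddle a → {A : Set a} → (ℕ ↣ A) → Maybe A ↣ A
Maybe-↣-infinite em {A} ι = mk↣ {to = to} λ {x} {y} → inj x y
  where
  open Injection ι using () renaming (to to room; injective to room-injective)

  Guest : A → Set _
  Guest x = ∃[ n ] room n ≡ x

  move : ∀ x → Dec (Guest x) → A
  move _ (yes (n , _)) = room (ℕ.suc n)
  move x (no _)        = x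

  to : Maybe A → A
  to nothing  = room zero
  to (just x) = move x em

  room-zero≢move : ∀ x (g? : Dec (Guest x)) → room zero ≢ move x g?
  room-zero≢move _ (yes _) eq = contradiction (room-injective eq) λ ()
  room-zero≢move _ (no ¬g) eq = ¬g (zero , eq)

  move-injective : ∀ x y (g? : Dec (Guest x)) (h? : Dec (Guest y)) →
    move x g? ≡ move y h? → x ≡ y
  move-injective _ _ (yes (m , refl)) (yes (n , refl)) eq =
    cong room (ℕ.suc-injective (room-injective eq))
  move-injective _ _ (yes (m , _)) (no ¬h) eq = contradiction (ℕ.suc m , eq) ¬h
  move-injective _ _ (no ¬g) (yes (n , _)) eq = contradiction (ℕ.suc n , sym eq) ¬g
  move-injective _ _ (no _) (no _) eq = eq

  inj : ∀ x y → to x ≡ to y → x ≡ y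
  inj nothing  nothing  _  = refl
  inj nothing  (just y) eq = contradiction eq (room-zero≢move y em)
  inj (just x) nothing  eq = contradiction (sym eq) (room-zero≢move x em)
  inj (just x) (just y) eq = cong just (move-injective x y em em eq)

-- Comparison with `ℕ` settles this without choice, as the set is well-ordered.
infinite⊎finite : ExcludedMiddle a → (A : WellOrder a) →
  let open WellOrder A in (ℕ ↣ Carrier) ⊎ ∃[ n ] (Carrier ↣ Fin n)
infinite⊎finite {a} em A = Sum.map₂
  (λ (n , A↔Seg) → n , ↣-trans (↔⇒↣ A↔Seg) (Seg↣Fin n))
  (comparable {a} {0ℓ} em A ℕ-wellOrder)
  where
  Seg↣Fin : ∀ n → WellOrder.Seg ℕ-wellOrder n ↣ Fin n
  Seg↣Fin n = mk↣ {to = λ i → fromℕ< (WellOrder.Seg< ℕ-wellOrder i)} λ eq →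
    value-injective (fromℕ<-injective _ _ _ _ eq)

-- Gödel's well-order on pairs.

module Gödel (A : WellOrder a) where
  open WellOrder A

  max : Carrier → Carrier → Carrier
  max x y with x <? y
  ... | yes _ = y
  ... | no _  = x

  max≮ˡ : ∀ x y → ¬ (max x y < x)
  max≮ˡ x y with x <? y
  ... | yes x<y = asym x<y
  ... | no _    = irrefl refl

  max≮ʳ : ∀ x y → ¬ (max x y < y)
  max≮ʳ x y with x <? y
  ... | yes _  = irrefl refl
  ... | no x≮y = x≮y

  ≮-trans : ∀ {x y z} → ¬ (x < y) → ¬ (y < z) → ¬ (x < z)
  ≮-trans {x} {y} x≮y y≮z x<z with compare x y
  ... | tri< x<y _ _  = x≮y x<y
  ... | tri≈ _ refl _ = y≮z x<z
  ... | tri> _ _ y<x  = y≮z (<-trans y<x x<z)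

  -- Putting the maximum first confines the pairs below `p` to the square of the closed segment up
  -- to the maximum of `p`.
  rank : Carrier × Carrier → Carrier × Carrier × Carrier
  rank (x , y) = max x y , x , y

  gödel : WellOrder a
  gödel = pullback
    (×-isStrictTotalOrder isStrictTotalOrder
      (×-isStrictTotalOrder isStrictTotalOrder isStrictTotalOrder))
    (×-wellFounded wellFounded (×-wellFounded wellFounded wellFounded))
    rank
    (λ (_ , x≡ , y≡) → cong₂ _,_ x≡ y≡)

  -- On elements not above `m`, `nothing` stands for `m` itself, so `Maybe (Seg m)` encodes the
  -- closed segment up to `m`.
  clip : ∀ m → Carrier → Maybe (Seg m)
  clip m x with x <? m
  ... | yes x<m = just (x , Irrelevant.[ x<m ])
  ... | no _    = nothing

  clip-injective : ∀ {m x y} → ¬ (m < x) → ¬ (m < y) → clip m x ≡ clip m y → x ≡ y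
  clip-injective {m} {x} {y} m≮x m≮y eq with x <? m | y <? m
  ... | yes _   | yes _   = cong value (just-injective eq)
  ... | no x≮m  | no y≮m  = trans (≈ x≮m m≮x) (sym (≈ y≮m m≮y))
    where
    ≈ : ∀ {x} → ¬ (x < m) → ¬ (m < x) → x ≡ m
    ≈ {x} x≮m m≮x with compare x m
    ... | tri< x<m _ _ = contradiction x<m x≮m
    ... | tri≈ _ eq _  = eq
    ... | tri> _ _ m<x = contradiction m<x m≮x

  Seg-gödel↣ : ∀ p → let m = max (proj₁ p) (proj₂ p) in
    WellOrder.Seg gödel p ↣ (Maybe (Seg m) × Maybe (Seg m))
  Seg-gödel↣ p = mk↣ {to = to} λ {q} {q′} eq → value-injective (cong₂ _,_
      (clip-injective (≮ˡ q) (≮ˡ q′) (,-injectiveˡ eq))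
      (clip-injective (≮ʳ q) (≮ʳ q′) (,-injectiveʳ eq)))
    where
    m = max (proj₁ p) (proj₂ p)
    to : WellOrder.Seg gödel p → Maybe (Seg m) × Maybe (Seg m)
    to q = let x , y = value q in clip m x , clip m y
    max≤ : ∀ (q : WellOrder.Seg gödel p) → ¬ (m < max (proj₁ (value q)) (proj₂ (value q)))
    max≤ q m<q with WellOrder.Seg< gödel q
    ... | inj₁ q<m       = asym q<m m<q
    ... | inj₂ (q≡m , _) = irrefl (sym q≡m) m<q
    ≮ˡ : ∀ (q : WellOrder.Seg gödel p) → ¬ (m < proj₁ (value q))
    ≮ˡ q = ≮-trans (max≤ q) (max≮ˡ _ (proj₂ (value q)))
    ≮ʳ : ∀ (q : WellOrder.Seg gödel p) → ¬ (m < proj₂ (value q))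
    ≮ʳ q = ≮-trans (max≤ q) (max≮ʳ (proj₁ (value q)) _)

-- Hessenberg's theorem.

module _ (em : ExcludedMiddle a) where

  -- Otherwise the carrier is a proper segment of Gödel's order and embeds in the square of a closed
  -- segment up to some `m`. If `Seg m` is infinite, this square embeds in `Seg m`, against
  -- `initial`; if it is finite, so is the carrier.
  initial⇒A×A↣A : (A : WellOrder a) → let open WellOrder A in
    (ℕ ↣ Carrier) → (∀ m → ¬ (Carrier ↣ Seg m)) →
    (∀ m → (ℕ ↣ Seg m) → (Seg m × Seg m) ↣ Seg m) →
    (Carrier × Carrier) ↣ Carrier
  initial⇒A×A↣A A ℕ↣A initial square with comparable {a} {a} em A (Gödel.gödel A)
  ... | inj₁ A×A↣A     = A×A↣A
  ... | inj₂ (p , A↔p) = contradiction A↣Maybe² ¬A↣Maybe²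
    where
    open WellOrder A
    m = Gödel.max A (proj₁ p) (proj₂ p)
    A↣Maybe² : Carrier ↣ (Maybe (Seg m) × Maybe (Seg m))
    A↣Maybe² = ↣-trans (↔⇒↣ A↔p) (Gödel.Seg-gödel↣ A p)
    ¬A↣Maybe² : ¬ (Carrier ↣ (Maybe (Seg m) × Maybe (Seg m)))
    ¬A↣Maybe² f with infinite⊎finite em (segment A m)
    ... | inj₁ ℕ↣m = initial m (↣-trans f (↣-trans (hotel ×-↣ hotel) (square m ℕ↣m)))
      where hotel = Maybe-↣-infinite em ℕ↣m
    ... | inj₂ (n , m↣n) =
      ℕ-not-↣Fin (↣-trans ℕ↣A (↣-trans f (↣-trans (g ×-↣ g) Fin-×↣)))
      where g = ↣-trans (Maybe-↣ m↣n) Maybe-Fin↣Fin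

  -- Induction on `x`. Either `Seg x` embeds in a smaller segment and inherits its pairing, or
  -- `Seg x` is itself initial and the previous lemma applies.
  Seg×Seg↣Seg : (A : WellOrder a) → let open WellOrder A in
    ∀ x → (ℕ ↣ Seg x) → (Seg x × Seg x) ↣ Seg x
  Seg×Seg↣Seg A x = go (wellFounded x)
    where
    open WellOrder A
    go : ∀ {x} → Acc _<_ x → (ℕ ↣ Seg x) → (Seg x × Seg x) ↣ Seg x
    go {x} (acc rs) ℕ↣x with em {∃[ y ] (y < x × Seg x ↣ Seg y)}
    ... | yes (y , y<x , x↣y) =
      ↣-trans (x↣y ×-↣ x↣y) (↣-trans (go (rs y<x) (↣-trans ℕ↣x x↣y)) (Seg-mono y<x))
    ... | no initial = initial⇒A×A↣A (segment A x) ℕ↣x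
      (λ d x↣d → initial (value d , Seg< d , ↣-trans x↣d (↔⇒↣ (segment-Seg A d))))
      λ d ℕ↣d → let S = segment-Seg A d ; s = ↔⇒↣ S in
        ↣-trans (s ×-↣ s) (↣-trans (go (rs (Seg< d)) (↣-trans ℕ↣d s)) (↔⇒↣ (↔-sym S)))

  module _ (κ : Cardinal a) where
    open Cardinal κ

    -- Cantor-Bernstein strengthens `initial` from bijections to injections.
    Carrier-not-↣Seg : ∀ m → ¬ (Carrier ↣ Seg m)
    Carrier-not-↣Seg m f =
      initial m (cantor-bernstein em f (WellOrder.value↣ (fromCardinal κ)))

    κ×κ↣κ : Infinite κ → (Carrier × Carrier) ↣ Carrier
    κ×κ↣κ ℕ↣κ = initial⇒A×A↣A (fromCardinal κ) ℕ↣κ Carrier-not-↣Seg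
      (Seg×Seg↣Seg (fromCardinal κ))

  -- Successor cardinals.

  module Successor (κ κ⁺ : Cardinal a) (succ : IsSuccessorOf κ⁺ κ) where
    private
      module κ  = Cardinal κ
      module κ⁺ = Cardinal κ⁺
      K⁺ = fromCardinal κ⁺

    κ↣κ⁺ : κ.Carrier ↣ κ⁺.Carrier
    κ↣κ⁺ = ↣-trans (↔⇒↣ (proj₂ (proj₁ succ))) (WellOrder.value↣ K⁺)

    κ⁺-not-↣κ : ¬ (κ⁺.Carrier ↣ κ.Carrier)
    κ⁺-not-↣κ f = Carrier-not-↣Seg κ⁺ _ (↣-trans f (↔⇒↣ (proj₂ (proj₁ succ))))

    -- Take the least `c` such that `Seg x` embeds in `Seg c`; by minimality `Seg c` is a cardinal.
    -- If it did not embed in `κ`, it would exceed `κ`, and leastness of `κ⁺` would embed `κ⁺` in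
    -- its own segment below `c`.
    Seg-κ⁺↣κ : ∀ x → κ⁺.Seg x ↣ κ.Carrier
    Seg-κ⁺↣κ x with least {a} {a} em κ⁺.wellFounded (λ y → κ⁺.Seg x ↣ κ⁺.Seg y) (x , mk↣ id)
    ... | c , x↣c , below with comparable {a} {a} em (fromCardinal κ) (segment K⁺ c)
    ... | inj₁ c↣κ = ↣-trans x↣c c↣κ
    ... | inj₂ κ<c = contradiction (proj₂ succ ν κ<c) (Carrier-not-↣Seg κ⁺ c)
      where
      -- The cardinality of Seg x.
      ν : Cardinal a
      ν = record
        { WellOrder (segment K⁺ c)
        ; initial = λ d c↔d → below (WellOrder.Seg< K⁺ d)
            (↣-trans x↣c (↣-trans (↔⇒↣ c↔d) (↔⇒↣ (segment-Seg K⁺ d))))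
        }

-- One-point models.

module _ {PROP : Set ℓ} where

  -- Here `R` is total and `_*` is the identity, so the connectives are classical.
  point : Pred PROP ℓ → Model PROP
  point V = record
    { W = ⊤ ; R = λ _ _ _ → ⊤ ; _* = id ; T = tt ; V = λ p _ → V p }

  point-isRM : ∀ V → IsRM (point V)
  point-isRM V = record
    { isR = record
      { isB = record
        { T-refl   = _
        ; T-trans  = _
        ; *-invol  = λ _ → refl
        ; *-anti   = _
        ; heredity = λ _ _ _ Vp _ → Vp
        }
      ; contra   = _
      ; assoc    = _
      ; diag     = _
      ; exchange = _
      }
    ; mingle = λ _ _ _ _ → inj₁ tt
    }

-- The hypotheses used by a derivation.

module _ {PROP : Set ℓ} {μ : Cardinal ℓ} {H : HilbertSystem PROP μ}
  {Γ : FormulaSet PROP μ} {φ : Formula PROP μ} (d : Derivation H Γ φ) where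
  open Cardinal μ using (Seg)
  open Derivation d
  open FormulaSet Γ

  hypothesis : ∀ {x y} {A : Set x} {B : Set y} {ψ : Formula PROP μ} →
    A ⊎ ψ ∈ Γ ⊎ B → Maybe Index
  hypothesis (inj₂ (inj₁ (j , _))) = just j
  hypothesis _                     = nothing

  hypothesisAt : Seg length → Maybe Index
  hypothesisAt i = hypothesis (step i)

  -- Each position contributes at most one hypothesis, so their number is bounded by the length of
  -- `d`.
  usedHypotheses : FormulaSet PROP μ
  usedHypotheses = record
    { Index  = Σ[ i ∈ Seg length ] Σ[ j ∈ Index ] hypothesisAt i ≡ just j
    ; member = λ (_ , j , _) → member j
    }

  fromUsedHypotheses : Derivation H usedHypotheses φ
  fromUsedHypotheses = record
    { length = length ; seq = seq ; end = end ; isLast = isLast ; ends = ends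
    ; step   = λ i → step′ i (step i) refl
    }
    where
    -- With the justification abstracted to `s`, matching on it turns the equation into the one that
    -- the index of `usedHypotheses` asks for.
    step′ : ∀ i {A B : Set (suc ℓ)} (s : A ⊎ seq i ∈ Γ ⊎ B) →
      hypothesisAt i ≡ hypothesis s → A ⊎ seq i ∈ usedHypotheses ⊎ B
    step′ i (inj₁ x)               eq = inj₁ x
    step′ i (inj₂ (inj₁ (j , j≡))) eq = inj₂ (inj₁ ((i , j , eq) , j≡))
    step′ i (inj₂ (inj₂ x))        eq = inj₂ (inj₂ x)

-- The pigeonhole theory.

module Pigeonhole {PROP : Set ℓ} {κ κ⁺ : Cardinal ℓ} (κ<κ⁺ : ∣ Cardinal.Carrier κ ∣< κ⁺)
  (code : (Cardinal.Carrier κ⁺ × Cardinal.Carrier κ) ↣ PROP) where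
  private
    module κ  = Cardinal κ
    module κ⁺ = Cardinal κ⁺

  p : κ⁺.Carrier → κ.Carrier → PROP
  p α i = Injection.to code (α , i)

  p-injective : ∀ {α β i j} → p α i ≡ p β j → (α , i) ≡ (β , j)
  p-injective = Injection.injective code

  -- Exclusivity is p α i ⟶ p β i ⟶ ⊥′ rather than a negation, since in a
  -- B-model ∼ φ may hold at T together with φ.
  Γ : FormulaSet PROP κ⁺
  Γ = record
    { Index  = κ⁺.Carrier ⊎ Σ[ (α , β , _) ∈ κ⁺.Carrier × κ⁺.Carrier × κ.Carrier ] α ≢ β
    ; member = λ
      { (inj₁ α)                 → ⋁ κ.Carrier κ<κ⁺ λ i → atom (p α i)
      ; (inj₂ ((α , β , i) , _)) → atom (p α i) ⟶ atom (p β i) ⟶ ⊥′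
      }
    }

  -- The disjunctions true at `t` supply the values. If distinct `α` and `β` shared a value, the
  -- exclusivity formula, applied twice along `R t t t`, would yield a contradiction.
  Γ⊨⇒↣ : ExcludedMiddle ℓ → ∀ {M} → IsB M →
    (∀ γ → γ ∈ Γ → M , Model.T M ⊩ γ) → κ⁺.Carrier ↣ κ.Carrier
  Γ⊨⇒↣ em {M} isB M⊩Γ = mk↣ {to = λ α → proj₁ (choice α)} λ {α} {β} eq →
    decidable-stable em λ α≢β →
      lower (M⊩Γ _ (inj₂ ((α , β , _) , α≢β) , refl)
        t t (T-refl t) (proj₂ (choice α))
        t t (T-refl t) (subst (λ i → V (p β i) t) (sym eq) (proj₂ (choice β))))
    where
    open Model M using (V) renaming (T to t)
    open IsB isB using (T-refl)
    choice : ∀ α → ∃[ i ] V (p α i) t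
    choice α = M⊩Γ _ (inj₁ α , refl)

  module _ {H : HilbertSystem PROP κ⁺} {φ : Formula PROP κ⁺} (d : Derivation H Γ φ)
    (h : κ⁺.Seg (Derivation.length d) ↣ κ.Carrier) where

    -- α is sent to the code of a position of d at which its disjunction is used.
    V : Pred PROP ℓ
    V q = ∃[ x ] ∃[ α ] (hypothesisAt d x ≡ just (inj₁ α) × q ≡ p α (Injection.to h x))

    -- By injectivity of `h`, the value `i` determines the position it codes, and a position
    -- determines the disjunction used there.
    V-exclusive : ∀ {α β i} → V (p α i) → V (p β i) → α ≡ β
    V-exclusive {α} {β} (x , α′ , at-x , eq) (y , β′ , at-y , eq′) =
      trans (,-injectiveˡ p≡) (trans α′≡β′ (sym (,-injectiveˡ p≡′)))
      where
      p≡ = p-injective eq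
      p≡′ = p-injective eq′
      x≡y : x ≡ y
      x≡y = Injection.injective h (trans (sym (,-injectiveʳ p≡)) (,-injectiveʳ p≡′))
      α′≡β′ : α′ ≡ β′
      α′≡β′ = inj₁-injective (just-injective
        (trans (sym at-x) (trans (cong (hypothesisAt d) x≡y) at-y)))

    -- A disjunction used at position `x` is witnessed by the code of `x`; the exclusivity formulas
    -- hold by `V-exclusive`.
    point⊩usedHypotheses : ∀ γ → γ ∈ usedHypotheses d → point V , tt ⊩ γ
    point⊩usedHypotheses _ ((x , inj₁ α , at-x) , refl) =
      Injection.to h x , x , α , at-x , refl
    point⊩usedHypotheses _ ((_ , inj₂ (_ , α≢β) , _) , refl) _ _ _ Vα _ _ _ Vβ =
      contradiction (V-exclusive Vα Vβ) α≢β

-- Failure of strong completeness.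

proposition4 : ∀ {ℓ} → ExcludedMiddle (suc ℓ) →
    (κ κ⁺ : Cardinal ℓ) → Infinite κ → IsSuccessorOf κ⁺ κ →
    (PROP : Set ℓ) → ∣ PROP ∣≥ κ⁺ →
    (Θ : Pred Sentence ℓ) → IsRM {PROP = PROP} ⊆ 𝕍 Θ →
    (H : HilbertSystem PROP κ⁺) → Sound H Θ →
    ¬ StronglyComplete H Θ
proposition4 {ℓ} em⁺ κ κ⁺ ℕ↣κ succ PROP κ⁺↣PROP Θ RM⊆𝕍 H sound complete =
  lower (sound (usedHypotheses d) ⊥′ (fromUsedHypotheses d) (point (V d h))
    (RM⊆𝕍 (point-isRM (V d h))) (point⊩usedHypotheses d h))
  where
  em : ExcludedMiddle ℓ
  em = lower-em em⁺

  open Successor em κ κ⁺ succ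

  code : (Cardinal.Carrier κ⁺ × Cardinal.Carrier κ) ↣ PROP
  -- The second factor is enlarged from `κ` to `κ⁺`, so that Hessenberg's theorem for `κ⁺` applies.
  code = ↣-trans (mk↣ id ×-↣ κ↣κ⁺) (↣-trans (κ×κ↣κ em κ⁺ (↣-trans ℕ↣κ κ↣κ⁺)) κ⁺↣PROP)

  open Pigeonhole {κ = κ} {κ⁺ = κ⁺} (proj₁ succ) code

  d : Derivation H Γ ⊥′
  -- The implication is vacuous: a model of `Γ` would embed `κ⁺` in `κ`.
  d = complete Γ ⊥′ λ M M∈𝕍 M⊩Γ →
    contradiction (Γ⊨⇒↣ em (𝕍.isB M∈𝕍) M⊩Γ) κ⁺-not-↣κ

  h : Cardinal.Seg κ⁺ (Derivation.length d) ↣ Cardinal.Carrier κ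
  h = Seg-κ⁺↣κ (Derivation.length d)
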